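{- For any $\eta>0$, there is an instance of Minimum Sum of Radii on which the primal-dual algorithm $\mathcal{A}$ described in the context computes a feasible solution whose cost is at least $(3-\eta)$ times the objective value $\sum_{j\in X}\alpha_j-k\lambda$ of the dual solution $(\lambda,\alpha)$ constructed by $\mathcal{A}$.
   Context: Minimum Sum of Radii: given a finite point set $X$ with metric $d$ (value $\infty$ allowed) and an integer $k$, choose at most $k$ centers $i_1,\dots,i_\ell\in X$ and radii $r_1,\dots,r_\ell\ge0$ such that each $j\in X$ satisfies $d(j,i_{\ell'})\le r_{\ell'}$ for some $\ell'$; minimize $\sum_{\ell'} r_{\ell'}$. Let $B(i,r)=\{j\in X: d(i,j)\le r\}$ and let $\mathcal{B}$ be the set of pairs $(i,r)$ with $i\in X$ and $r=d(i,j)<\infty$ for some $j\in X$. The dual LP is: maximize $\sum_{j\in X}\alpha_j-k\lambda$ subject to $\sum_{j\in B(i,r)}\alpha_j\le r+\lambda$ for all $(i,r)\in\mathcal{B}$, and $\alpha_j\ge 0$, $\lambda\ge0$. A pair $(i,r)\in\mathcal{B}$ is tight for $(\lambda,\alpha)$ if $\sum_{j\in B(i,r)}\alpha_j=r+\lambda$. The components of a set of pairs are the connected components of the graph with one vertex per pair, two pairs being adjacent if their balls intersect. Algorithm $\mathcal{A}$ (on an instance $(X,k)$): start with $\alpha_j=0$ for all $j\in X$ and $\lambda=0$. While the set of tight pairs has more than $k$ components: (1) greedily select an inclusion-maximal set $X''\subseteq X$ such that each tight pair covers at most one point of $X''$ (process the points in arbitrary order, inserting a point $j$ if no tight pair covering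 $j$ covers a point already in $X''$); (2) let $$\delta=\min_{(i,r)\in\mathcal{B}}\left\{\frac{r+\lambda-\sum_{j\in B(i,r)}\alpha_j}{|B(i,r)\cap X''|-1}: |B(i,r)\cap X''|\ge 2 \text{ and } (i,r)\text{ is not tight}\right\},$$ and increase $\lambda$ and each $\alpha_j$ with $j\in X''$ by $\delta$. When the tight pairs form at most $k$ components, stop; the current $(\lambda,\alpha)$ is the constructed dual solution. Let $\mathcal{B}_0$ be the set of tight pairs after the penultimate iteration and $\mathcal{B}_1$ the set of tight pairs after the last iteration (if there is only one iteration, $\mathcal{B}_0$ is the set of pairs tight at the start; if there is no iteration, start instead from $\{(j,0):j\in X\}$ and greedily add further tight pairs). Starting from $\mathcal{B}_0\cap\mathcal{B}_1$, add pairs of $\mathcal{B}_1\setminus\mathcal{B}_0$ in arbitrary order until the number of components is at most $k$; call the result $\mathcal{B}'$. The computed feasible solution consists, for each component $C$ of $\mathcal{B}'$, of one pair $(i,r)$ with $i\in X$ of smallest radius $r$ such that $B(i,r)$ contains all points covered by pairs in $C$. -}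

module Defs where

open import Level using (0ℓ) renaming (suc to lsuc)
open import Data.Bool.Base using (if_then_else_)
open import Data.Fin.Base using (Fin)
open import Data.Fin.Subset as Subset using (Subset; ∣_∣; Nonempty; ⁅_⁆)
open import Data.Integer.Base as ℤ using ()
open import Data.List.Base as List using (List; []; _∷_; length; allFin)
open import Data.List.Relation.Binary.Permutation.Propositional using (_↭_)
open import Data.List.Relation.Binary.Pointwise using (Pointwise)
open import Data.List.Relation.Unary.All using (All)
open import Data.List.Relation.Unary.AllPairs using (AllPairs)
open import Data.List.Relation.Unary.Any using (Any)
open import Data.Nat.Base as ℕ using (ℕ)
import Data.Nat.Properties as ℕ
open import Data.Product.Base using (_×_; _,_; proj₂; ∃-syntax)
open import Data.Rational.Base using (ℚ; 0ℚ; _+_; _*_; _-_; _≤_; _/_)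
open import Data.Rational.Properties using (+-0-commutativeMonoid; _≤?_)
open import Data.Vec.Base using (lookup; tabulate)
open import Function.Metric.Structures using (IsGeneralMetric)
open import Relation.Binary.Construct.Add.Supremum.NonStrict _≤_ using (_≤⁺_; ≤⁺-dec)
open import Relation.Binary.Construct.Closure.ReflexiveTransitive using (Star)
open import Relation.Binary.Core using (Rel)
open import Relation.Binary.PropositionalEquality using (_≡_)
open import Relation.Nullary using (¬_; does)
open import Relation.Nullary.Construct.Add.Supremum using (_⁺; [_]; ⊤⁺)
open import Relation.Unary using (Pred; _∈_; _∉_; _∩_; _∪_; ｛_｝)

open import Algebra.Properties.CommutativeMonoid.Sum +-0-commutativeMonoid using (sum)

-- ℚ ⁺ adjoins the distance ∞ = ⊤⁺.
infixl 6 _+⁺_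
_+⁺_ : ℚ ⁺ → ℚ ⁺ → ℚ ⁺
[ p ] +⁺ [ q ] = [ p + q ]
[ _ ] +⁺ ⊤⁺    = ⊤⁺
⊤⁺    +⁺ _     = ⊤⁺

record Instance : Set where
  field
    n        : ℕ
    k        : ℕ
    d        : Fin n → Fin n → ℚ ⁺
    isMetric : IsGeneralMetric _≡_ _≡_ _≤⁺_ [ 0ℚ ] _+⁺_ d

sumOver : ∀ {n} → Subset n → (Fin n → ℚ) → ℚ
sumOver S f = sum (λ j → if lookup S j then f j else 0ℚ)

module MinSumRadii (I : Instance) where
  open Instance I

  X : Set
  X = Fin n

  Pair : Set
  Pair = X × ℚ

  ball : Pair → Subset n
  ball (i , r) = tabulate (λ j → does (≤⁺-dec _≤?_ (d i j) [ r ]))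

  Feasible : List Pair → Set
  Feasible sol =
      length sol ℕ.≤ k
    × All (λ (_ , r) → 0ℚ ≤ r) sol
    × (∀ j → Any (λ (i , r) → d j i ≤⁺ [ r ]) sol)

  cost : List Pair → ℚ
  cost sol = List.foldr _+_ 0ℚ (List.map proj₂ sol)

  𝓑 : Pred Pair 0ℓ
  𝓑 (i , r) = ∃[ j ] d i j ≡ [ r ]

  record Dual : Set where
    constructor ⟨_,_⟩
    field
      lam : ℚ
      α   : X → ℚ
  open Dual public

  dualValue : Dual → ℚ
  dualValue D = sum (α D) - (ℤ.+ k / 1) * lam D

  slack : Dual → Pair → ℚ
  slack D (i , r) = (r + lam D) - sumOver (ball (i , r)) (α D)

  Tight : Dual → Pred Pair 0ℓ
  Tight D (i , r) = (i , r) ∈ 𝓑 × sumOver (ball (i , r)) (α D) ≡ r + lam D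

  PairSet : Set₁
  PairSet = Pred Pair 0ℓ

  Adjacent : PairSet → Rel Pair 0ℓ
  Adjacent T b b′ = b ∈ T × b′ ∈ T × Nonempty (ball b Subset.∩ ball b′)

  Connected : PairSet → Rel Pair 0ℓ
  Connected T = Star (Adjacent T)

  -- A component is named by any one of its pairs; the list below contains
  -- exactly one pair from each component of T.
  record Components (T : PairSet) (reps : List Pair) : Set where
    field
      within   : All (_∈ T) reps
      separate : AllPairs (λ b b′ → ¬ Connected T b b′) reps
      complete : ∀ {b} → b ∈ T → Any (λ c → Connected T c b) reps

  AtMostComponents : ℕ → PairSet → Set
  AtMostComponents m T = ∃[ reps ] Components T reps × length reps ℕ.≤ m

  Clash : PairSet → Rel X 0ℓ
  Clash T j j′ = ∃[ b ] b ∈ T × j Subset.∈ ball b × j′ Subset.∈ ball b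

  -- Greedy T js S S′: processing the points js in this order, starting from
  -- the selection S, ends with the selection S′.
  data Greedy (T : PairSet) : List X → Rel (Subset n) 0ℓ where
    done   : ∀ {S} → Greedy T [] S S
    insert : ∀ {j js S S′} →
             (∀ {j′} → j′ Subset.∈ S → ¬ Clash T j j′) →
             Greedy T js (⁅ j ⁆ Subset.∪ S) S′ →
             Greedy T (j ∷ js) S S′
    skip   : ∀ {j js S S′} →
             (∃[ j′ ] j′ Subset.∈ S × Clash T j j′) →
             Greedy T js S S′ →
             Greedy T (j ∷ js) S S′

  Selected : PairSet → Subset n → Set
  Selected T X″ = ∃[ order ] (order ↭ allFin n) × Greedy T order Subset.⊥ X″

  hits : Subset n → Pair → ℕ
  hits X″ b = ∣ ball b Subset.∩ X″ ∣

  ratio : Dual → (X″ : Subset n) (b : Pair) → 2 ℕ.≤ hits X″ b → ℚ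
  ratio D X″ b 2≤h = slack D b * (ℤ.+ 1 / (hits X″ b ℕ.∸ 1))
    where instance _ = ℕ.>-nonZero (ℕ.∸-monoˡ-≤ 1 2≤h)

  Ratios : Dual → Subset n → Pred ℚ 0ℓ
  Ratios D X″ δ =
    ∃[ b ] b ∈ 𝓑 × b ∉ Tight D × (∃[ 2≤h ] δ ≡ ratio D X″ b 2≤h)

  IsMinimum : Pred ℚ 0ℓ → ℚ → Set
  IsMinimum P δ = δ ∈ P × (∀ {ε} → ε ∈ P → δ ≤ ε)

  raise : Dual → Subset n → ℚ → Dual
  raise D X″ δ = ⟨ lam D + δ , (λ j → if lookup X″ j then α D j + δ else α D j) ⟩

  initial : Dual
  initial = ⟨ 0ℚ , (λ _ → 0ℚ) ⟩

  Stops : Dual → Set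
  Stops D = AtMostComponents k (Tight D)

  data Iteration (D : Dual) : Dual → Set where
    iterate : ∀ {X″ δ} →
              ¬ Stops D →
              Selected (Tight D) X″ →
              IsMinimum (Ratios D X″) δ →
              Iteration D (raise D X″ δ)

  -- Augment S T T′: T′ arises from T by adding pairs of S one at a time until
  -- there are at most k components.
  data Augment (S : PairSet) : PairSet → PairSet → Set (lsuc 0ℓ) where
    stop : ∀ {T} → AtMostComponents k T → Augment S T T
    add  : ∀ {T T′ b} →
           ¬ AtMostComponents k T →
           b ∈ S → b ∉ T →
           Augment S (T ∪ ｛ b ｝) T′ →
           Augment S T T′

  singletons : PairSet
  singletons (_ , r) = r ≡ 0ℚ

  -- MainPhase D 𝓑′: some run of the while loop ends with the dual solution D
  -- and some order of adding pairs then yields 𝓑′.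
  data MainPhase : Dual → PairSet → Set (lsuc 0ℓ) where
    noIteration : ∀ {𝓑′} →
      Stops initial →
      Augment (Tight initial) singletons 𝓑′ →
      MainPhase initial 𝓑′
    iterations  : ∀ {D₀ D₁ 𝓑′} →
      Star Iteration initial D₀ →
      Iteration D₀ D₁ →
      Stops D₁ →
      Augment (λ b → b ∈ Tight D₁ × b ∉ Tight D₀) (Tight D₀ ∩ Tight D₁) 𝓑′ →
      MainPhase D₁ 𝓑′

  Encloses : PairSet → Pair → Pair → Set
  Encloses T c b = ∀ {b′} → b′ ∈ T → Connected T c b′ → ball b′ Subset.⊆ ball b

  SmallestEnclosing : PairSet → Pair → Pair → Set
  SmallestEnclosing T c b =
    Encloses T c b × (∀ {b′} → Encloses T c b′ → proj₂ b ≤ proj₂ b′)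

  data Output : Dual → List Pair → Set (lsuc 0ℓ) where
    output : ∀ {D 𝓑′ reps sol} →
             MainPhase D 𝓑′ →
             Components 𝓑′ reps →
             Pointwise (SmallestEnclosing 𝓑′) reps sol →
             Output D sol

{-# OPTIONS --safe #-}

-- Take k = 1 and m = s + 1 columns, each with an apex a_l and s further points
-- p_{l,1}, …, p_{l,s}.  Distinct points are at distance 2 within a type; an apex
-- and a p are at distance 3 in the same column and 1 in different columns.
-- The first iteration raises λ and every α_j to 1/s².  Then every star B(a_l, 1),
-- which has s² + 1 points, becomes tight, and the stars overlap, so the algorithm
-- stops with dual value (m² - 1)/s² = (s + 2)/s.  Every point has eccentricity 3,
-- so a single ball covering everything has radius at least 3.
module Submission where

open import Defs

open import Data.Bool.Base using (Bool; true; false; if_then_else_)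
open import Data.Fin.Base as Fin using (Fin; zero; suc; toℕ; fromℕ<; combine; remQuot; _↑ˡ_; _↑ʳ_)
import Data.Fin.Properties as Fin
open import Data.Fin.Subset as Subset using (Subset; ∣_∣; ⁅_⁆)
import Data.Fin.Subset.Properties as Subset
open import Data.Integer.Base as ℤ using (+_; -[1+_]; +≤+)
import Data.Integer.Properties as ℤ
open import Data.List.Base using (List; []; _∷_; length; allFin)
import Data.List.Membership.Propositional as List
open import Data.List.Membership.Propositional.Properties using (∈-allFin)
open import Data.List.Relation.Binary.Permutation.Propositional using (↭-refl; ↭-sym)
open import Data.List.Relation.Binary.Permutation.Propositional.Properties using (∈-resp-↭)
open import Data.List.Relation.Binary.Pointwise using (Pointwise; []; _∷_)
open import Data.List.Relation.Unary.All as All using (All; []; _∷_)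
open import Data.List.Relation.Unary.AllPairs using ([]; _∷_)
open import Data.List.Relation.Unary.Any using (Any; here; there)
open import Data.List.Relation.Unary.Unique.Propositional using (Unique)
open import Data.List.Relation.Unary.Unique.Propositional.Properties using (allFin⁺)
open import Data.Nat.Base as ℕ using (ℕ; zero; suc; z≤n; s≤s)
open import Data.Nat.Coprimality as Coprime using (1-coprimeTo)
import Data.Nat.Properties as ℕ
open import Data.Nat.Tactic.RingSolver using (solve-∀)
open import Data.Product.Base using (_×_; _,_; proj₁; proj₂; Σ-syntax; ∃-syntax; ∃₂)
open import Data.Rational.Base
  using (ℚ; mkℚ; 0ℚ; 1ℚ; _+_; _*_; _-_; -_; _<_; _≤_; *<*; _/_; ↧ₙ_; toℚᵘ; nonNegative)
import Data.Rational.Properties as ℚ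
open import Data.Rational.Unnormalised.Base as ℚᵘ using (mkℚᵘ; *≡*; *≤*)
import Data.Rational.Unnormalised.Properties as ℚᵘ
open import Data.Sum.Base as Sum using (_⊎_; inj₁; inj₂)
open import Data.Vec.Base using ([]; _∷_; tabulate)
open import Data.Vec.Functional using (removeAt)
open import Data.Vec.Properties using (lookup-replicate; lookup∘tabulate; lookup⇒[]=; []=⇒lookup)
open import Function.Base using (_∘_)
open import Function.Bundles using (mk⇔)
open import Relation.Binary.Construct.Add.Supremum.NonStrict _≤_
  using (_≤⁺_; [_]; ≤⁺-dec; [≤]-injective; ≤⁺-isPartialOrder-≡)
open import Relation.Binary.Construct.Closure.ReflexiveTransitive using (Star; ε; _◅_; _◅◅_; reverse)
open import Relation.Binary.PropositionalEquality
open import Relation.Nullary using (¬_; Dec; yes; no; does; contradiction)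
open import Relation.Nullary.Construct.Add.Supremum using (_⁺; [_])
open import Relation.Nullary.Decidable using (dec-true; dec-false; does-⇔)
open import Relation.Unary using (_∈_; _∉_; _∩_; _∪_; ｛_｝; _⊆_)

open import Algebra.Properties.CommutativeMonoid.Sum ℚ.+-0-commutativeMonoid as ℚ∑ using (sum)
import Algebra.Properties.CommutativeMonoid.Sum ℕ.+-0-commutativeMonoid as ℕ∑

-- Rational arithmetic

ι : ℕ → ℚ
ι n = + n / 1

-- Normalisation divides by a gcd, which is stuck for a variable `n`; the explicit reduced fraction
-- lets comparisons, sums and products of `ι` values unfold.
ι≡mkℚ : ∀ n → ι n ≡ mkℚ (+ n) 0 (Coprime.sym (1-coprimeTo n))
ι≡mkℚ n = ℚ.normalize-coprime (Coprime.sym (1-coprimeTo n))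

-- Among unnormalised fractions the order is cross-multiplication, and normalising changes a
-- fraction only up to equivalence.
/-mono : ∀ a b c d .{{_ : ℕ.NonZero b}} .{{_ : ℕ.NonZero d}} →
         a ℕ.* d ℕ.≤ c ℕ.* b → + a / b ≤ + c / d
/-mono a b@(suc b-1) c d@(suc d-1) ad≤cb = ℚ.toℚᵘ-cancel-≤ (begin
  toℚᵘ (+ a / b)  ≃⟨ ℚ.toℚᵘ-fromℚᵘ (mkℚᵘ (+ a) b-1) ⟩
  mkℚᵘ (+ a) b-1  ≤⟨ *≤* (subst₂ ℤ._≤_ (ℤ.pos-* a d) (ℤ.pos-* c b) (+≤+ ad≤cb)) ⟩
  mkℚᵘ (+ c) d-1  ≃⟨ ℚ.toℚᵘ-fromℚᵘ (mkℚᵘ (+ c) d-1) ⟨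
  toℚᵘ (+ c / d)  ∎)
  where open ℚᵘ.≤-Reasoning

ι-mono : ∀ {a b} → a ℕ.≤ b → ι a ≤ ι b
ι-mono {a} {b} a≤b = /-mono a 1 b 1 (ℕ.*-monoˡ-≤ 1 a≤b)

ι-cancel-≤ : ∀ {a b} → ι a ≤ ι b → a ℕ.≤ b
ι-cancel-≤ {a} {b} a≤b =
  ℤ.drop‿+≤+ (subst₂ ℤ._≤_ (ℤ.*-identityʳ (+ a)) (ℤ.*-identityʳ (+ b))
    (ℚ.drop-*≤* (subst₂ _≤_ (ι≡mkℚ a) (ι≡mkℚ b) a≤b)))

ι-injective : ∀ {a b} → ι a ≡ ι b → a ≡ b
ι-injective e =
  ℕ.≤-antisym (ι-cancel-≤ (ℚ.≤-reflexive e)) (ι-cancel-≤ (ℚ.≤-reflexive (sym e)))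

ι-+ : ∀ a b → ι (a ℕ.+ b) ≡ ι a + ι b
ι-+ a b = trans
  (cong (_/ 1) (cong₂ ℤ._+_ (sym (ℤ.*-identityʳ (+ a))) (sym (ℤ.*-identityʳ (+ b)))))
  (sym (cong₂ _+_ (ι≡mkℚ a) (ι≡mkℚ b)))

ι-* : ∀ a b → ι (a ℕ.* b) ≡ ι a * ι b
ι-* a b =
  trans (cong (_/ 1) (ℤ.pos-* a b)) (sym (cong₂ _*_ (ι≡mkℚ a) (ι≡mkℚ b)))

ι*1/ : ∀ a b .{{_ : ℕ.NonZero b}} → ι a * (+ 1 / b) ≡ + a / b
ι*1/ a b@(suc b-1) = ℚ.toℚᵘ-injective (begin-equality
  toℚᵘ (ι a * (+ 1 / b))               ≃⟨ ℚ.toℚᵘ-homo-* (ι a) (+ 1 / b) ⟩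
  toℚᵘ (ι a) ℚᵘ.* toℚᵘ (+ 1 / b)       ≃⟨ ℚᵘ.*-cong (ℚ.toℚᵘ-fromℚᵘ (mkℚᵘ (+ a) 0)) (ℚ.toℚᵘ-fromℚᵘ (mkℚᵘ (+ 1) b-1)) ⟩
  mkℚᵘ (+ a) 0 ℚᵘ.* mkℚᵘ (+ 1) b-1     ≃⟨ *≡* (cong₂ ℤ._*_ (ℤ.*-identityʳ (+ a)) (cong (+_ ∘ suc) (sym (ℕ.+-identityʳ b-1)))) ⟩
  mkℚᵘ (+ a) b-1                       ≃⟨ ℚ.toℚᵘ-fromℚᵘ (mkℚᵘ (+ a) b-1) ⟨
  toℚᵘ (+ a / b)                       ∎)
  where open ℚᵘ.≤-Reasoning

n/n≡1 : ∀ n .{{_ : ℕ.NonZero n}} → + n / n ≡ 1ℚ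
n/n≡1 n = ℚ.≤-antisym (/-mono n n 1 1 le) (/-mono 1 1 n n (ℕ.≤-reflexive (ℕ.*-comm 1 n)))
  where
  le : n ℕ.* 1 ℕ.≤ 1 ℕ.* n
  le = ℕ.≤-reflexive (ℕ.*-comm n 1)

-- Counting

ind : Bool → ℕ
ind b = if b then 1 else 0

# : ∀ {n} → (Fin n → Bool) → ℕ
# p = ℕ∑.sum (ind ∘ p)

∣tabulate∣ : ∀ {n} (p : Fin n → Bool) → ∣ tabulate p ∣ ≡ # p
∣tabulate∣ {zero}  p = refl
∣tabulate∣ {suc n} p with p zero
... | true  = cong suc (∣tabulate∣ (p ∘ suc))
... | false = ∣tabulate∣ (p ∘ suc)

sum-const : ∀ {n} (f : Fin n → ℕ) w → (∀ j → f j ≡ w) → ℕ∑.sum f ≡ n ℕ.* w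
sum-const {zero}  f w f≡w = refl
sum-const {suc n} f w f≡w = cong₂ ℕ._+_ (f≡w zero) (sum-const (f ∘ suc) w (f≡w ∘ suc))

sum-const-except : ∀ {n} (f : Fin (suc n) → ℕ) i w →
                   (∀ j → j ≢ i → f j ≡ w) → ℕ∑.sum f ≡ f i ℕ.+ n ℕ.* w
sum-const-except f i w f≡w = trans (ℕ∑.sum-remove {i = i} f)
  (cong (f i ℕ.+_) (sum-const (removeAt f i) w (λ j → f≡w _ (Fin.punchInᵢ≢i i j))))

sum-++ : ∀ a {b} (f : Fin (a ℕ.+ b) → ℕ) →
         ℕ∑.sum f ≡ ℕ∑.sum (λ i → f (i ↑ˡ b)) ℕ.+ ℕ∑.sum (λ j → f (a ↑ʳ j))
sum-++ zero    f = refl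
sum-++ (suc a) f = trans (cong (f zero ℕ.+_) (sum-++ a (f ∘ suc))) (sym (ℕ.+-assoc (f zero) _ _))

sum-combine : ∀ a {b} (f : Fin (a ℕ.* b) → ℕ) →
              ℕ∑.sum f ≡ ℕ∑.sum (λ (i : Fin a) → ℕ∑.sum (λ (j : Fin b) → f (combine i j)))
sum-combine zero        f = refl
sum-combine (suc a) {b} f = trans (sum-++ b f)
  (cong (ℕ∑.sum (λ j → f (j ↑ˡ a ℕ.* b)) ℕ.+_) (sum-combine a (λ j → f (b ↑ʳ j))))

sumOver-const : ∀ {n} (S : Subset n) (f : Fin n → ℚ) v →
                (∀ j → f j ≡ v) → sumOver S f ≡ ι ∣ S ∣ * v
sumOver-const []          f v f≡v = sym (ℚ.*-zeroˡ v)
sumOver-const (true  ∷ S) f v f≡v = begin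
  f zero + sumOver S (f ∘ suc)  ≡⟨ cong₂ _+_ (f≡v zero) (sumOver-const S (f ∘ suc) v (f≡v ∘ suc)) ⟩
  v + ι ∣ S ∣ * v               ≡⟨ cong (_+ ι ∣ S ∣ * v) (ℚ.*-identityˡ v) ⟨
  ι 1 * v + ι ∣ S ∣ * v         ≡⟨ ℚ.*-distribʳ-+ v (ι 1) (ι ∣ S ∣) ⟨
  (ι 1 + ι ∣ S ∣) * v           ≡⟨ cong (_* v) (ι-+ 1 ∣ S ∣) ⟨
  ι (suc ∣ S ∣) * v             ∎
  where open ≡-Reasoning
sumOver-const (false ∷ S) f v f≡v =
  trans (ℚ.+-identityˡ _) (sumOver-const S (f ∘ suc) v (f≡v ∘ suc))

sum-constℚ : ∀ {n} (f : Fin n → ℚ) v → (∀ j → f j ≡ v) → sum f ≡ ι n * v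
sum-constℚ {n} f v f≡v = begin
  sum f                  ≡⟨ ℚ∑.sum-cong-≗ (λ j → cong (if_then f j else 0ℚ) (lookup-replicate j true)) ⟨
  sumOver Subset.⊤ f     ≡⟨ sumOver-const Subset.⊤ f v f≡v ⟩
  ι ∣ Subset.⊤ {n} ∣ * v ≡⟨ cong (λ c → ι c * v) (Subset.∣⊤∣≡n n) ⟩
  ι n * v                ∎
  where open ≡-Reasoning

⊤-unique : ∀ {n} (S : Subset n) → (∀ j → j Subset.∈ S) → S ≡ Subset.⊤
⊤-unique S all = Subset.⊆-antisym Subset.⊆⊤ (λ _ → all _)

does⁻ : ∀ {a} {A : Set a} (A? : Dec A) → does A? ≡ true → A
does⁻ (yes a) _ = a

-- The metric

module Grid (t : ℕ) where

  -- `2 ≤ s` provides the three columns for `third`, and `2 * s ≤ s * s` for balls of radius at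
  -- least 2.
  s m : ℕ
  s = 2 ℕ.+ t
  m = suc s

  cross : Fin m → Fin m → ℕ
  cross l l′ = if does (l Fin.≟ l′) then 3 else 1

  -- (l , zero) encodes a_l, and (l , suc c) encodes p_{l,c+1} (counting c from 0).
  far : Fin m × Fin m → Fin m × Fin m → ℕ
  far (l , zero)  (l′ , zero)  = 2
  far (l , suc _) (l′ , suc _) = 2
  far (l , zero)  (l′ , suc _) = cross l l′
  far (l , suc _) (l′ , zero)  = cross l l′

  cross-self : ∀ l → cross l l ≡ 3
  cross-self l = cong (if_then 3 else 1) (dec-true (l Fin.≟ l) refl)

  cross-≢ : ∀ {l l′} → l ≢ l′ → cross l l′ ≡ 1
  cross-≢ {l} {l′} l≢l′ = cong (if_then 3 else 1) (dec-false (l Fin.≟ l′) l≢l′)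

  cross-sym : ∀ l l′ → cross l l′ ≡ cross l′ l
  cross-sym l l′ = cong (if_then 3 else 1) (does-⇔ (mk⇔ sym sym) (l Fin.≟ l′) (l′ Fin.≟ l))

  1≤cross : ∀ l l′ → 1 ℕ.≤ cross l l′
  1≤cross l l′ with does (l Fin.≟ l′)
  ... | true  = s≤s z≤n
  ... | false = s≤s z≤n

  cross≤3 : ∀ l l′ → cross l l′ ℕ.≤ 3
  cross≤3 l l′ with does (l Fin.≟ l′)
  ... | true  = ℕ.≤-refl
  ... | false = s≤s z≤n

  far-sym : ∀ u v → far u v ≡ far v u
  far-sym (l , zero)  (l′ , zero)  = refl
  far-sym (l , suc _) (l′ , suc _) = refl
  far-sym (l , zero)  (l′ , suc _) = cross-sym l l′
  far-sym (l , suc _) (l′ , zero)  = cross-sym l l′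

  1≤far : ∀ u v → 1 ℕ.≤ far u v
  1≤far (l , zero)  (l′ , zero)  = s≤s z≤n
  1≤far (l , suc _) (l′ , suc _) = s≤s z≤n
  1≤far (l , zero)  (l′ , suc _) = 1≤cross l l′
  1≤far (l , suc _) (l′ , zero)  = 1≤cross l l′

  far≤3 : ∀ u v → far u v ℕ.≤ 3
  far≤3 (l , zero)  (l′ , zero)  = s≤s (s≤s z≤n)
  far≤3 (l , suc _) (l′ , suc _) = s≤s (s≤s z≤n)
  far≤3 (l , zero)  (l′ , suc _) = cross≤3 l l′
  far≤3 (l , suc _) (l′ , zero)  = cross≤3 l l′

  -- All values lie between 1 and 3. For endpoints of one type the left side is 2, at most 1 + 1.
  -- For endpoints of different types the middle point shares its type with one of them, so the
  -- right side is at least 2 + 1.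
  far-triangle : ∀ u v w → far u w ℕ.≤ far u v ℕ.+ far v w
  far-triangle u@(_ , zero)  v           w@(_ , zero)  = ℕ.+-mono-≤ (1≤far u v) (1≤far v w)
  far-triangle u@(_ , suc _) v           w@(_ , suc _) = ℕ.+-mono-≤ (1≤far u v) (1≤far v w)
  far-triangle u@(_ , zero)  v@(_ , zero)  w@(_ , suc _) =
    ℕ.≤-trans (far≤3 u w) (ℕ.+-monoʳ-≤ 2 (1≤far v w))
  far-triangle u@(_ , zero)  v@(_ , suc _) w@(_ , suc _) =
    ℕ.≤-trans (far≤3 u w) (ℕ.+-monoˡ-≤ 2 (1≤far u v))
  far-triangle u@(_ , suc _) v@(_ , suc _) w@(_ , zero)  =
    ℕ.≤-trans (far≤3 u w) (ℕ.+-monoʳ-≤ 2 (1≤far v w))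
  far-triangle u@(_ , suc _) v@(_ , zero)  w@(_ , zero)  =
    ℕ.≤-trans (far≤3 u w) (ℕ.+-monoˡ-≤ 2 (1≤far u v))

  -- Opacity keeps the normaliser from unrolling the index arithmetic and the m * m entries of a ball.
  opaque
    size : ℕ
    size = m ℕ.* m

  Point : Set
  Point = Fin size

  opaque
    unfolding size

    size≡m*m : size ≡ m ℕ.* m
    size≡m*m = refl

    at : Fin m → Fin m → Point
    at = combine

    coords : Point → Fin m × Fin m
    coords = remQuot m

    coords-at : ∀ l c → coords (at l c) ≡ (l , c)
    coords-at = Fin.remQuot-combine

    at-surjective : ∀ x → ∃₂ λ l c → at l c ≡ x
    at-surjective = Fin.combine-surjective {m} {m}

    sum-at : ∀ f → ℕ∑.sum f ≡ ℕ∑.sum (λ l → ℕ∑.sum (λ c → f (at l c)))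
    sum-at = sum-combine m {m}

    -- Needs `size` unfolded: `sum-const-except` speaks of a successor, and `m * m` reduces to one.
    sum-indicator : ∀ (f : Point → ℕ) x → (∀ y → y ≢ x → f y ≡ 0) → ℕ∑.sum f ≡ f x
    sum-indicator f x f≡0 = trans (sum-const-except f x 0 f≡0)
      (trans (cong (f x ℕ.+_) (ℕ.*-zeroʳ (ℕ.pred (m ℕ.* m)))) (ℕ.+-identityʳ (f x)))

  at-injective : ∀ {l c l′ c′} → at l c ≡ at l′ c′ → (l , c) ≡ (l′ , c′)
  at-injective {l} {c} {l′} {c′} e =
    trans (sym (coords-at l c)) (trans (cong coords e) (coords-at l′ c′))

  opaque
    -- The diagonal is set separately because `far` takes the value 2 on equal coordinates.
    dist : Point → Point → ℕ
    dist x y = if does (x Fin.≟ y) then 0 else far (coords x) (coords y)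

    dist-self : ∀ x → dist x x ≡ 0
    dist-self x = cong (if_then 0 else far (coords x) (coords x)) (dec-true (x Fin.≟ x) refl)

    dist-≢ : ∀ {x y} → x ≢ y → dist x y ≡ far (coords x) (coords y)
    dist-≢ {x} {y} x≢y =
      cong (if_then 0 else far (coords x) (coords y)) (dec-false (x Fin.≟ y) x≢y)

    dist-sym : ∀ x y → dist x y ≡ dist y x
    dist-sym x y = cong₂ (if_then 0 else_)
      (does-⇔ (mk⇔ sym sym) (x Fin.≟ y) (y Fin.≟ x)) (far-sym (coords x) (coords y))

    dist≤3 : ∀ x y → dist x y ℕ.≤ 3
    dist≤3 x y with does (x Fin.≟ y)
    ... | true  = z≤n
    ... | false = far≤3 (coords x) (coords y)

  dist≡0⇒≡ : ∀ {x y} → dist x y ≡ 0 → x ≡ y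
  dist≡0⇒≡ {x} {y} d≡0 with x Fin.≟ y
  ... | yes x≡y = x≡y
  ... | no  x≢y = contradiction (trans (sym (dist-≢ x≢y)) d≡0)
                                (ℕ.>⇒≢ (1≤far (coords x) (coords y)))

  dist-triangle : ∀ x y z → dist x z ℕ.≤ dist x y ℕ.+ dist y z
  dist-triangle x y z with x Fin.≟ y | y Fin.≟ z | x Fin.≟ z
  ... | yes refl | _        | _        = ℕ.m≤n+m (dist x z) (dist x x)
  ... | no _     | yes refl | _        = ℕ.m≤m+n (dist x z) (dist z z)
  ... | no _     | no _     | yes refl = ℕ.≤-trans (ℕ.≤-reflexive (dist-self x)) z≤n
  ... | no x≢y   | no y≢z   | no x≢z   =
    subst₂ ℕ._≤_ (sym (dist-≢ x≢z)) (sym (cong₂ ℕ._+_ (dist-≢ x≢y) (dist-≢ y≢z)))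
      (far-triangle (coords x) (coords y) (coords z))

  dist-at : ∀ l c l′ c′ → (l , c) ≢ (l′ , c′) → dist (at l c) (at l′ c′) ≡ far (l , c) (l′ , c′)
  dist-at l c l′ c′ ≢ =
    trans (dist-≢ (≢ ∘ at-injective)) (cong₂ far (coords-at l c) (coords-at l′ c′))

  antipode : ∀ x → ∃[ y ] dist x y ≡ 3
  antipode x with at-surjective x
  ... | l , zero  , refl = at l (suc zero) , trans (dist-at l zero l (suc zero) (λ ())) (cross-self l)
  ... | l , suc c , refl = at l zero , trans (dist-at l (suc c) l zero (λ ())) (cross-self l)

  -- The points p of this third column are at distance 1 from both apexes, which is why any two
  -- stars intersect. With equal arguments it supplies another column.
  third : ∀ (i j : Fin m) → ∃[ l ] i ≢ l × j ≢ l
  third zero          zero          = suc zero , (λ ()) , (λ ())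
  third zero          (suc zero)    = suc (suc zero) , (λ ()) , (λ ())
  third zero          (suc (suc _)) = suc zero , (λ ()) , (λ ())
  third (suc zero)    zero          = suc (suc zero) , (λ ()) , (λ ())
  third (suc (suc _)) zero          = suc zero , (λ ()) , (λ ())
  third (suc _)       (suc _)       = zero , (λ ()) , (λ ())

  apex : Fin m → Point
  apex l = at l zero

  dist-apex : ∀ {i l} c → i ≢ l → dist (apex i) (at l (suc c)) ≡ 1
  dist-apex {i} {l} c i≢l = trans (dist-at i zero l (suc c) (λ ())) (cross-≢ i≢l)

  apex-separated : ∀ {i j} → dist (apex i) (apex j) ℕ.≤ 1 → i ≡ j
  apex-separated {i} {j} d≤1 with i Fin.≟ j
  ... | yes i≡j = i≡j
  ... | no  i≢j = contradiction
    (subst (ℕ._≤ 1) (dist-at i zero j zero (i≢j ∘ cong proj₁)) d≤1) λ { (s≤s ()) }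

  -- The stars cover all points, so a ball that contains its centre meets some star.
  near-some-apex : ∀ x → ∃[ i ] dist (apex i) x ℕ.≤ 1
  near-some-apex x with at-surjective x
  ... | l , zero  , refl = l , ℕ.≤-trans (ℕ.≤-reflexive (dist-self (apex l))) z≤n
  ... | l , suc c , refl with i , l≢i , _ ← third l l =
    i , ℕ.≤-reflexive (dist-apex c (l≢i ∘ sym))

  -- Sizes of the balls of radius 0 and 1

  within : ℕ → ℕ → ℕ
  within r e = ind (does (e ℕ.≤? r))

  ballSize : Point → ℕ → ℕ
  ballSize x r = # (λ y → does (dist x y ℕ.≤? r))

  ballSize-0 : ∀ x → ballSize x 0 ≡ 1
  ballSize-0 x = trans
    (sum-indicator (λ y → within 0 (dist x y)) x
      (λ y y≢x → cong ind (dec-false (dist x y ℕ.≤? 0)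
        (λ d≤0 → y≢x (sym (dist≡0⇒≡ (ℕ.n≤0⇒n≡0 d≤0)))))))
    (cong (within 0) (dist-self x))

  -- The number of points that each foreign column has at distance 1 from `at l c`: its `s` points p
  -- if `c` marks an apex, and its apex alone otherwise.
  opposite : Fin m → ℕ
  opposite zero    = s
  opposite (suc _) = 1

  -- In the own column every other point is at distance 2 or 3, so only the centre counts; each of
  -- the `s` other columns contributes `opposite c`.
  ballSize-1 : ∀ l c → ballSize (at l c) 1 ≡ 1 ℕ.+ s ℕ.* opposite c
  ballSize-1 l c = begin
    ballSize (at l c) 1                           ≡⟨ sum-at (within 1 ∘ dist (at l c)) ⟩
    ℕ∑.sum (λ l′ → column c l′)                   ≡⟨ sum-const-except (column c) l (opposite c) (λ l′ l′≢l → other-column c l′ (l′≢l ∘ sym)) ⟩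
    column c l ℕ.+ s ℕ.* opposite c               ≡⟨ cong (ℕ._+ s ℕ.* opposite c) (own-column c) ⟩
    1 ℕ.+ s ℕ.* opposite c                        ∎
    where
    open ≡-Reasoning

    column : Fin m → Fin m → ℕ
    column c l′ = ℕ∑.sum (λ c′ → within 1 (dist (at l c) (at l′ c′)))

    own-far : ∀ c c′ → within 1 (far (l , c) (l , c′)) ≡ 0
    own-far zero    zero    = refl
    own-far (suc _) (suc _) = refl
    own-far zero    (suc _) = cong (within 1) (cross-self l)
    own-far (suc _) zero    = cong (within 1) (cross-self l)

    own-column : ∀ c → column c l ≡ 1
    own-column c = trans
      (sum-const-except (λ c′ → within 1 (dist (at l c) (at l c′))) c 0
        (λ c′ c′≢c → trans (cong (within 1) (dist-at l c l c′ (c′≢c ∘ sym ∘ cong proj₂))) (own-far c c′)))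
      (cong₂ ℕ._+_ (cong (within 1) (dist-self (at l c))) (ℕ.*-zeroʳ s))

    other-column : ∀ c l′ → l ≢ l′ → column c l′ ≡ opposite c
    other-column c l′ l≢l′ = trans
      (ℕ∑.sum-cong-≗ (λ c′ → cong (within 1) (dist-at l c l′ c′ (l≢l′ ∘ cong proj₁))))
      (count c)
      where
      count : ∀ c → ℕ∑.sum (λ c′ → within 1 (far (l , c) (l′ , c′))) ≡ opposite c
      -- The exceptional index is the apex of column `l′`: seen from an apex it is at distance 2 and
      -- counts 0, while in the next clause it is the only point counted.
      count zero    = trans
        (sum-const-except (λ c′ → within 1 (far (l , zero) (l′ , c′))) zero 1
          λ { zero 0≢0 → contradiction refl 0≢0 ; (suc _) _ → cong (within 1) (cross-≢ l≢l′) })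
        (ℕ.*-identityʳ s)
      count (suc c) = trans
        (sum-const-except (λ c′ → within 1 (far (l , suc c) (l′ , c′))) zero 0
          λ { zero 0≢0 → contradiction refl 0≢0 ; (suc _) _ → refl })
        (cong₂ ℕ._+_ (cong (within 1) (cross-≢ l≢l′)) (ℕ.*-zeroʳ s))

-- Facts about the algorithm on an arbitrary instance

module Algorithm (I : Instance) where
  open Instance I
  open MinSumRadii I

  ∈-ball⁺ : ∀ {i j r} → d i j ≤⁺ [ r ] → j Subset.∈ ball (i , r)
  ∈-ball⁺ {i} {j} {r} d≤r = lookup⇒[]= j (ball (i , r))
    (trans (lookup∘tabulate _ j) (dec-true (≤⁺-dec ℚ._≤?_ (d i j) [ r ]) d≤r))

  ∈-ball⁻ : ∀ {i j r} → j Subset.∈ ball (i , r) → d i j ≤⁺ [ r ]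
  ∈-ball⁻ {i} {j} {r} j∈ = does⁻ (≤⁺-dec ℚ._≤?_ (d i j) [ r ])
    (trans (sym (lookup∘tabulate _ j)) ([]=⇒lookup j∈))

  adjacent : ∀ {T b b′ j} → b ∈ T → b′ ∈ T →
             j Subset.∈ ball b → j Subset.∈ ball b′ → Connected T b b′
  adjacent b∈ b′∈ j∈b j∈b′ = (b∈ , b′∈ , _ , Subset.x∈p∩q⁺ (j∈b , j∈b′)) ◅ ε

  connected-sym : ∀ {T b b′} → Connected T b b′ → Connected T b′ b
  connected-sym = reverse λ {b} {b′} (b∈ , b′∈ , j , j∈) →
    b′∈ , b∈ , j , subst (j Subset.∈_) (Subset.∩-comm (ball b) (ball b′)) j∈

  atMostOne⇒connected : ∀ {T b b′} → AtMostComponents 1 T → b ∈ T → b′ ∈ T → Connected T b b′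
  atMostOne⇒connected (reps , comps , len) b∈ b′∈ = go reps len (complete b∈) (complete b′∈)
    where
    open Components comps
    go : ∀ {T b b′} reps → length reps ℕ.≤ 1 →
         Any (λ c → Connected T c b) reps → Any (λ c → Connected T c b′) reps → Connected T b b′
    go (_ ∷ [])    _        (here p) (here q) = connected-sym p ◅◅ q
    go (_ ∷ _ ∷ _) (s≤s ())

  -- The representatives from which an output is built need not be those witnessing
  -- `AtMostComponents`; two separate ones would still be connected through the single witness.
  components-length≤1 : ∀ {T reps} → Components T reps → AtMostComponents 1 T → length reps ℕ.≤ 1
  components-length≤1 {reps = []}        comps one = z≤n
  components-length≤1 {reps = _ ∷ []}    comps one = s≤s z≤n
  components-length≤1 {reps = _ ∷ _ ∷ _} comps one with comps
  ... | record { within = b∈ ∷ b′∈ ∷ _ ; separate = (b≁b′ ∷ _) ∷ _ } =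
    contradiction (atMostOne⇒connected one b∈ b′∈) b≁b′

  greedy-⊆ : ∀ {T js S S′} → Greedy T js S S′ → S Subset.⊆ S′
  greedy-⊆ done         = λ j∈ → j∈
  greedy-⊆ (insert _ g) = greedy-⊆ g ∘ Subset.x∈p∪q⁺ ∘ inj₂
  greedy-⊆ (skip _ g)   = greedy-⊆ g

  ClashFree : PairSet → Set
  ClashFree T = ∀ {j j′} → Clash T j j′ → j ≡ j′

  -- A point is skipped only if it clashes with a selected one; under `ClashFree` that is the point
  -- itself, so it is already selected.
  greedy-all : ∀ {T js S S′ j} → ClashFree T → Greedy T js S S′ → j List.∈ js → j Subset.∈ S′
  greedy-all free (insert _ g)              (here refl) = greedy-⊆ g (Subset.x∈p∪q⁺ (inj₁ (Subset.x∈⁅x⁆ _)))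
  greedy-all free (skip (j′ , j′∈ , cl) g)  (here refl) = greedy-⊆ g (subst (Subset._∈ _) (sym (free cl)) j′∈)
  greedy-all free (insert _ g)              (there j∈)  = greedy-all free g j∈
  greedy-all free (skip _ g)                (there j∈)  = greedy-all free g j∈

  selected-all : ∀ {T X″} → ClashFree T → Selected T X″ → X″ ≡ Subset.⊤
  selected-all free (_ , perm , g) =
    ⊤-unique _ (λ j → greedy-all free g (∈-resp-↭ (↭-sym perm) (∈-allFin j)))

  -- `insert` forbids a clash with the selection, and under `ClashFree` a point can clash only with
  -- itself. So every point can be inserted once the list is duplicate-free and disjoint from `S`.
  greedy-exists : ∀ {T} → ClashFree T → ∀ js S → Unique js →
                  All (Subset._∉ S) js → ∃[ S′ ] Greedy T js S S′
  greedy-exists free []       S []          []        = S , done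
  greedy-exists free (j ∷ js) S (j≢ ∷ uniq) (j∉ ∷ js∉)
    with S′ , g ← greedy-exists free js (⁅ j ⁆ Subset.∪ S) uniq
           (All.zipWith (λ (j≢i , i∉) → Sum.[ j≢i ∘ sym ∘ Subset.x∈⁅y⁆⇒x≡y j , i∉ ] ∘ Subset.x∈p∪q⁻ ⁅ j ⁆ S) (j≢ , js∉))
    = S′ , insert (λ j′∈ cl → j∉ (subst (Subset._∈ S) (sym (free cl)) j′∈)) g

  selected-⊤ : ∀ {T} → ClashFree T → Selected T Subset.⊤
  selected-⊤ {T} free
    with S′ , g ← greedy-exists free (allFin n) Subset.⊥ (allFin⁺ n) (All.tabulate (λ _ → Subset.∉⊥))
    = subst (Selected T) (selected-all free sel) sel
    where
    sel : Selected T S′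
    sel = allFin n , ↭-refl , g

  augment-⊆ : ∀ {S T T′} → Augment S T T′ → T ⊆ T′
  augment-⊆ (stop _)      b∈ = b∈
  augment-⊆ (add _ _ _ a) b∈ = augment-⊆ a (inj₁ b∈)

  augment-atMost : ∀ {S T T′} → Augment S T T′ → AtMostComponents k T′
  augment-atMost (stop few)    = few
  augment-atMost (add _ _ _ a) = augment-atMost a

  minimum-unique : ∀ {P δ ε} → IsMinimum P δ → IsMinimum P ε → δ ≡ ε
  minimum-unique (δ∈ , δ≤) (ε∈ , ε≤) = ℚ.≤-antisym (δ≤ ε∈) (ε≤ δ∈)

  -- On the instance below a run meets only two dual solutions, with common value 0 and then `c`.
  -- Agreement of `α` at each point is all that the sums need.
  Uniform : Dual → ℚ → Set
  Uniform D v = lam D ≡ v × (∀ j → α D j ≡ v)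

  uniform-tight : ∀ {D v i r} → Uniform D v → (i , r) ∈ 𝓑 →
                  ι ∣ ball (i , r) ∣ * v ≡ r + v → (i , r) ∈ Tight D
  uniform-tight {D} {i = i} {r} (lam≡ , α≡) b∈ eq =
    b∈ , trans (sumOver-const (ball (i , r)) (α D) _ α≡) (trans eq (cong (λ l → r + l) (sym lam≡)))

  sumOver-initial : ∀ S → sumOver S (α initial) ≡ 0ℚ
  sumOver-initial S = trans (sumOver-const S _ 0ℚ (λ _ → refl)) (ℚ.*-zeroʳ (ι ∣ S ∣))

  slack-initial : ∀ i r → slack initial (i , r) ≡ r
  slack-initial i r = trans
    (cong₂ _-_ (ℚ.+-identityʳ r) (sumOver-initial (ball (i , r)))) (ℚ.+-identityʳ r)

  tight-initial⇒radius≡0 : ∀ {b} → b ∈ Tight initial → proj₂ b ≡ 0ℚ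
  tight-initial⇒radius≡0 {i , r} (_ , eq) =
    trans (sym (ℚ.+-identityʳ r)) (trans (sym eq) (sumOver-initial (ball (i , r))))

  raise-⊤-uniform : ∀ v → Uniform (raise initial Subset.⊤ v) v
  raise-⊤-uniform v = ℚ.+-identityˡ v , λ j →
    trans (cong (if_then 0ℚ + v else 0ℚ) (lookup-replicate j true)) (ℚ.+-identityˡ v)

-- The bad instance

module LowerBound (t : ℕ) where
  open Grid t

  K : ℕ
  K = s ℕ.* s

  -- The length of the only raise: a star has radius 1 and `K` points besides its centre.
  c : ℚ
  c = + 1 / K

  inst : Instance
  inst = record
    { n = size
    ; k = 1
    ; d = λ x y → [ ι (dist x y) ]
    ; isMetric = record
      { isSemiMetric = record
        { isQuasiSemiMetric = record
          { isPreMetric = record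
            { isProtoMetric = record
              { isPartialOrder  = ≤⁺-isPartialOrder-≡ ℚ.≤-isPartialOrder
              ; ≈-isEquivalence = isEquivalence
              ; cong            = λ { refl refl → refl }
              ; nonNegative     = λ {x} {y} → [ ι-mono {0} {dist x y} z≤n ]
              }
            ; ≈⇒0 = λ { {x} refl → cong (λ e → [ ι e ]) (dist-self x) }
            }
          ; 0⇒≈ = λ { {x} {y} e → dist≡0⇒≡ (ι-injective ([]-injective e)) }
          }
        ; sym = λ x y → cong (λ e → [ ι e ]) (dist-sym x y)
        }
      ; triangle = λ x y z → [ ℚ.≤-trans (ι-mono (dist-triangle x y z))
                                  (ℚ.≤-reflexive (ι-+ (dist x y) (dist y z))) ]
      }
    }
    where
    []-injective : ∀ {p q : ℚ} → _≡_ {A = ℚ ⁺} [ p ] [ q ] → p ≡ q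
    []-injective refl = refl

  open Instance inst using (n; d)
  open MinSumRadii inst
  open Algorithm inst

  near⇒∈ : ∀ {x y} r → dist x y ℕ.≤ r → y Subset.∈ ball (x , ι r)
  near⇒∈ r d≤r = ∈-ball⁺ [ ι-mono d≤r ]

  ∈⇒near : ∀ {x y} r → y Subset.∈ ball (x , ι r) → dist x y ℕ.≤ r
  ∈⇒near {x} {y} r y∈ = ι-cancel-≤ ([≤]-injective (∈-ball⁻ {i = x} {j = y} y∈))

  ∈-ball-0 : ∀ {x y} → y Subset.∈ ball (x , 0ℚ) → x ≡ y
  ∈-ball-0 y∈ = dist≡0⇒≡ (ℕ.n≤0⇒n≡0 (∈⇒near 0 y∈))

  centre∈ : ∀ {x} r → x Subset.∈ ball (x , ι r)
  centre∈ {x} r = near⇒∈ r (ℕ.≤-trans (ℕ.≤-reflexive (dist-self x)) z≤n)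

  ∣ball∣ : ∀ x r → ∣ ball (x , ι r) ∣ ≡ ballSize x r
  ∣ball∣ x r = trans (∣tabulate∣ (λ y → does (≤⁺-dec ℚ._≤?_ (d x y) [ ι r ])))
    (ℕ∑.sum-cong-≗ (λ y → cong ind (does-⇔
      (mk⇔ (ι-cancel-≤ ∘ [≤]-injective) ([_] ∘ ι-mono))
      (≤⁺-dec ℚ._≤?_ (d x y) [ ι r ]) (dist x y ℕ.≤? r))))

  hits-⊤ : ∀ x r → hits Subset.⊤ (x , ι r) ≡ ballSize x r
  hits-⊤ x r = trans (cong ∣_∣ (Subset.∩-identityʳ (ball (x , ι r)))) (∣ball∣ x r)

  size≡ : size ≡ suc (K ℕ.+ 2 ℕ.* s)
  size≡ = trans size≡m*m (go s)
    where
    go : ∀ s → suc s ℕ.* suc s ≡ suc (s ℕ.* s ℕ.+ 2 ℕ.* s)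
    go = solve-∀

  opposite≤s : ∀ l → opposite l ℕ.≤ s
  opposite≤s zero    = ℕ.≤-refl
  opposite≤s (suc _) = s≤s z≤n

  -- This is what keeps every initial ratio at or above `1 / K`. Radius 1 is the exact count,
  -- largest at an apex. From radius 2 on the whole space is small enough: besides the centre it has
  -- `K + 2 * s ≤ 2 * K` points.
  ballSize-pred≤ : ∀ x e → e ≢ 0 → ℕ.pred (ballSize x e) ℕ.≤ e ℕ.* K
  ballSize-pred≤ x 0 e≢0 = contradiction refl e≢0
  ballSize-pred≤ x 1 _ with l , i , refl ← at-surjective x = begin
    ℕ.pred (ballSize (at l i) 1)   ≡⟨ cong ℕ.pred (ballSize-1 l i) ⟩
    s ℕ.* opposite i               ≤⟨ ℕ.*-monoʳ-≤ s (opposite≤s i) ⟩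
    K                              ≡⟨ ℕ.*-identityˡ K ⟨
    1 ℕ.* K                        ∎
    where open ℕ.≤-Reasoning
  ballSize-pred≤ x e@(suc (suc e′)) _ = begin
    ℕ.pred (ballSize x e)          ≡⟨ cong ℕ.pred (∣ball∣ x e) ⟨
    ℕ.pred ∣ ball (x , ι e) ∣      ≤⟨ ℕ.pred-mono-≤ (Subset.∣p∣≤n (ball (x , ι e))) ⟩
    ℕ.pred size                    ≡⟨ cong ℕ.pred size≡ ⟩
    K ℕ.+ 2 ℕ.* s                  ≤⟨ ℕ.+-monoʳ-≤ K (ℕ.*-monoˡ-≤ s {2} {s} (s≤s (s≤s z≤n))) ⟩
    K ℕ.+ K                        ≡⟨ cong (K ℕ.+_) (ℕ.+-identityʳ K) ⟨
    2 ℕ.* K                        ≤⟨ ℕ.*-monoˡ-≤ K {2} {e} (s≤s (s≤s z≤n)) ⟩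
    e ℕ.* K                        ∎
    where open ℕ.≤-Reasoning

  ιK*c≡1 : ι K * c ≡ 1ℚ
  ιK*c≡1 = trans (ι*1/ K K) (n/n≡1 K)

  -- Tight pairs before and after the raise

  star : Fin m → Pair
  star l = apex l , ι 1

  neighbour : ∀ l → ∃[ y ] dist (apex l) y ≡ 1
  neighbour l with l′ , l≢l′ , _ ← third l l = at l′ (suc zero) , dist-apex zero l≢l′

  star∈𝓑 : ∀ l → star l ∈ 𝓑
  star∈𝓑 l = let y , e = neighbour l in y , cong (λ e → [ ι e ]) e

  point∈𝓑 : ∀ x → (x , 0ℚ) ∈ 𝓑
  point∈𝓑 x = x , cong (λ e → [ ι e ]) (dist-self x)

  -- A ball of radius 0 holds one point, so tightness reads `v = 0 + v` and survives the raise.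
  point-tight : ∀ {D v} x → Uniform D v → (x , 0ℚ) ∈ Tight D
  point-tight {v = v} x u = uniform-tight u (point∈𝓑 x)
    (trans (cong (λ h → ι h * v) (trans (∣ball∣ x 0) (ballSize-0 x)))
      (trans (ℚ.*-identityˡ v) (sym (ℚ.+-identityˡ v))))

  -- The `K + 1` points of a star carry `(K + 1) / K = 1 + c` in total.
  star-tight : ∀ {D} l → Uniform D c → star l ∈ Tight D
  star-tight l u = uniform-tight u (star∈𝓑 l) (begin
    ι ∣ ball (star l) ∣ * c   ≡⟨ cong (λ h → ι h * c) (trans (∣ball∣ (apex l) 1) (ballSize-1 l zero)) ⟩
    ι (1 ℕ.+ K) * c           ≡⟨ cong (_* c) (ι-+ 1 K) ⟩
    (ι 1 + ι K) * c           ≡⟨ ℚ.*-distribʳ-+ c (ι 1) (ι K) ⟩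
    ι 1 * c + ι K * c         ≡⟨ cong₂ _+_ (ℚ.*-identityˡ c) ιK*c≡1 ⟩
    c + ι 1                   ≡⟨ ℚ.+-comm c (ι 1) ⟩
    ι 1 + c                   ∎)
    where open ≡-Reasoning

  initial-uniform : Uniform initial 0ℚ
  initial-uniform = refl , λ _ → refl

  tight-initial-point : ∀ {b} → b ∈ Tight initial → b ≡ (proj₁ b , 0ℚ)
  tight-initial-point {x , r} b∈ = cong (x ,_) (tight-initial⇒radius≡0 b∈)

  star∉initial : ∀ l → star l ∉ Tight initial
  star∉initial l b∈ = contradiction (ι-injective {1} {0} (tight-initial⇒radius≡0 b∈)) λ ()

  initial-ball : ∀ {b j} → b ∈ Tight initial → j Subset.∈ ball b → b ≡ (j , 0ℚ)
  initial-ball {b} {j} b∈ j∈ = trans b≡ (cong (_, 0ℚ) (∈-ball-0 (subst (λ b → j Subset.∈ ball b) b≡ j∈)))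
    where
    b≡ : b ≡ (proj₁ b , 0ℚ)
    b≡ = tight-initial-point b∈

  initial-clashFree : ClashFree (Tight initial)
  initial-clashFree (b , b∈ , j∈ , j′∈) =
    cong proj₁ (trans (sym (initial-ball b∈ j∈)) (initial-ball b∈ j′∈))

  -- Components of sets of pairs

  ContainsPoints : PairSet → Set
  ContainsPoints T = ∀ x → (x , 0ℚ) ∈ T

  touches : ∀ {T x b} → Adjacent T (x , 0ℚ) b → x Subset.∈ ball b
  touches {x = x} {b} (_ , _ , y , y∈) = subst (Subset._∈ ball b) (sym (∈-ball-0 (proj₁ both))) (proj₂ both)
    where
    both : y Subset.∈ ball (x , 0ℚ) × y Subset.∈ ball b
    both = Subset.x∈p∩q⁻ (ball (x , 0ℚ)) (ball b) y∈

  -- A step out of `(x , 0ℚ)` leads to a pair whose ball contains `x`, hence back to `(x , 0ℚ)`.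
  isolated : ∀ {T x b} → (∀ {b} → b ∈ T → x Subset.∈ ball b → b ≡ (x , 0ℚ)) →
             Connected T (x , 0ℚ) b → b ≡ (x , 0ℚ)
  isolated only ε = refl
  isolated {T} {x} {b} only (step@(_ , b₁∈ , _) ◅ path) = go (only b₁∈ (touches {T} step)) path
    where
    go : ∀ {b₁} → b₁ ≡ (x , 0ℚ) → Connected T b₁ b → b ≡ (x , 0ℚ)
    go refl path = isolated only path

  -- With one component, the isolated pair at `apex l` would be connected to that of another point;
  -- `at l (suc zero)` serves as this point.
  isolated⇒¬one : ∀ {T l} → ContainsPoints T →
                  (∀ {b} → b ∈ T → apex l Subset.∈ ball b → b ≡ (apex l , 0ℚ)) →
                  ¬ AtMostComponents 1 T
  isolated⇒¬one {T} {l} points only one =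
    contradiction (at-injective (cong proj₁ (isolated only
      (atMostOne⇒connected one (points (apex l)) (points (at l (suc zero))))))) λ ()

  ¬stops-initial : ¬ Stops initial
  ¬stops-initial = isolated⇒¬one {l = zero} (λ x → point-tight x initial-uniform) initial-ball

  stars-connected : ∀ {T} → (∀ l → star l ∈ T) → ∀ l l′ → Connected T (star l) (star l′)
  stars-connected stars l l′ = let i , l≢i , l′≢i = third l l′ in
    adjacent (stars l) (stars l′)
      (near⇒∈ 1 (ℕ.≤-reflexive (dist-apex zero l≢i)))
      (near⇒∈ 1 (ℕ.≤-reflexive (dist-apex zero l′≢i)))

  -- Radii of pairs in `𝓑` are distances, so each ball contains its centre, which lies in some star;
  -- the stars are connected to each other through third columns.
  one-component : ∀ {T} → T ⊆ 𝓑 → (∀ l → star l ∈ T) → Components T (star zero ∷ [])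
  one-component {T} T⊆𝓑 stars = record
    { within   = stars zero ∷ []
    ; separate = [] ∷ []
    ; complete = λ b∈ → here (connect b∈)
    }
    where
    connect : ∀ {b} → b ∈ T → Connected T (star zero) b
    connect {x , r} b∈ = go (T⊆𝓑 b∈) b∈
      where
      go : ∀ {r} → (x , r) ∈ 𝓑 → (x , r) ∈ T → Connected T (star zero) (x , r)
      go (y , refl) b∈ = let l , d≤1 = near-some-apex x in
        stars-connected stars zero l ◅◅ adjacent (stars l) b∈ (near⇒∈ 1 d≤1) (centre∈ (dist x y))

  uniform-stops : ∀ {D} → Uniform D c → Stops D
  uniform-stops u = star zero ∷ [] , one-component proj₁ (λ l → star-tight l u) , ℕ.≤-refl

  -- The first and only iteration

  star-hits : ∀ l → hits Subset.⊤ (star l) ≡ suc K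
  star-hits l = trans (hits-⊤ (apex l) 1) (ballSize-1 l zero)

  ratio-≡ : ∀ {b X″} e (2≤h : 2 ℕ.≤ hits X″ b) → proj₂ b ≡ ι e →
            ratio initial X″ b 2≤h ≡ (+ e / (hits X″ b ℕ.∸ 1)) {{ℕ.>-nonZero (ℕ.∸-monoˡ-≤ 1 2≤h)}}
  ratio-≡ {i , r} {X″} e 2≤h r≡ = trans
    (cong (_* (+ 1 / (hits X″ (i , r) ℕ.∸ 1))) (trans (slack-initial i r) r≡))
    (ι*1/ e (hits X″ (i , r) ℕ.∸ 1))
    where instance _ = ℕ.>-nonZero (ℕ.∸-monoˡ-≤ 1 2≤h)

  -- At the start the slack of a pair is its radius, and all points are selected, so the ratio is
  -- the radius divided by the ball size minus one. Stars attain `1 / K`, and `ballSize-pred≤`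
  -- excludes anything smaller.
  c-minimum : IsMinimum (Ratios initial Subset.⊤) c
  c-minimum = (star zero , star∈𝓑 zero , star∉initial zero , 2≤h , attained) , least
    where
    2≤h : 2 ℕ.≤ hits Subset.⊤ (star zero)
    2≤h = subst (2 ℕ.≤_) (sym (star-hits zero)) (s≤s (s≤s z≤n))

    attained : c ≡ ratio initial Subset.⊤ (star zero) 2≤h
    attained = trans (ℚ./-cong {p₁ = + 1} refl (sym (cong ℕ.pred (star-hits zero))))
                     (sym (ratio-≡ {star zero} 1 2≤h refl))
      where instance _ = ℕ.>-nonZero (ℕ.∸-monoˡ-≤ 1 2≤h)

    least : ∀ {ε} → ε ∈ Ratios initial Subset.⊤ → c ≤ ε
    least ((x , r) , (y , refl) , b∉ , 2≤h , refl) = ℚ.≤-trans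
      (/-mono 1 K (dist x y) (hits Subset.⊤ (x , r) ℕ.∸ 1)
        (ℕ.≤-trans (ℕ.≤-reflexive (trans (ℕ.*-identityˡ _) (cong ℕ.pred (hits-⊤ x (dist x y)))))
          (ballSize-pred≤ x (dist x y) e≢0)))
      (ℚ.≤-reflexive (sym (ratio-≡ {x , r} (dist x y) 2≤h refl)))
      where
      instance _ = ℕ.>-nonZero (ℕ.∸-monoˡ-≤ 1 2≤h)
      -- Pairs of radius 0 are tight at the start and so excluded from the minimum.
      e≢0 : dist x y ≢ 0
      e≢0 e = b∉ (subst (λ e → (x , ι e) ∈ Tight initial) (sym e) (point-tight x initial-uniform))

  -- Neither the processing order nor the minimising pair matters: the selection is forced to be
  -- everything, and a minimum is unique.
  first-iteration : ∀ {D} → Iteration initial D → Uniform D c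
  first-iteration (iterate _ sel min) = go (selected-all initial-clashFree sel) min
    where
    go : ∀ {X″ δ} → X″ ≡ Subset.⊤ → IsMinimum (Ratios initial X″) δ →
         Uniform (raise initial X″ δ) c
    go refl min = subst (λ δ → Uniform (raise initial Subset.⊤ δ) c)
                        (minimum-unique c-minimum min) (raise-⊤-uniform c)

  D₁ : Dual
  D₁ = raise initial Subset.⊤ c

  D₁-uniform : Uniform D₁ c
  D₁-uniform = raise-⊤-uniform c

  iteration-D₁ : Iteration initial D₁
  iteration-D₁ = iterate ¬stops-initial (selected-⊤ initial-clashFree) c-minimum

  -- After any first iteration the stopping condition holds, so no second one can start.
  single-iteration : ∀ {D D′} → Star Iteration initial D → Iteration D D′ → D ≡ initial
  single-iteration ε _ = refl
  single-iteration (it ◅ ε) (iterate ¬stops _ _) =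
    contradiction (uniform-stops (first-iteration it)) ¬stops
  single-iteration (it ◅ iterate ¬stops _ _ ◅ _) _ =
    contradiction (uniform-stops (first-iteration it)) ¬stops

  -- Covers all choices made in a run. The point pairs are tight before and after the raise, so the
  -- augmentation starts with them and keeps them.
  main-phase : ∀ {D 𝓑′} → MainPhase D 𝓑′ →
               Uniform D c × ContainsPoints 𝓑′ × AtMostComponents 1 𝓑′
  main-phase (noIteration stops _) = contradiction stops ¬stops-initial
  main-phase (iterations run it _ aug) = go (single-iteration run it) it aug
    where
    go : ∀ {D₀ D S 𝓑′} → D₀ ≡ initial → Iteration D₀ D → Augment S (Tight D₀ ∩ Tight D) 𝓑′ →
         Uniform D c × ContainsPoints 𝓑′ × AtMostComponents 1 𝓑′
    go {D = D} refl it aug =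
        u
      , (λ x → augment-⊆ aug (point-tight x initial-uniform , point-tight x u))
      , augment-atMost aug
      where
      u : Uniform D c
      u = first-iteration it

  -- Feasibility and cost of every output

  enclosing-all : ∀ {T b b′} → ContainsPoints T → AtMostComponents 1 T → b ∈ T →
                  Encloses T b b′ → ∀ x → x Subset.∈ ball b′
  enclosing-all points one b∈ enc x =
    enc (points x) (atMostOne⇒connected one b∈ (points x)) (centre∈ 0)

  enclosing-radius : ∀ {i r} → (∀ x → x Subset.∈ ball (i , r)) → ι 3 ≤ r
  enclosing-radius {i} {r} all = let y , e = antipode i in
    subst (λ e → ι e ≤ r) e ([≤]-injective (∈-ball⁻ {i = i} {j = y} (all y)))

  -- There is exactly one representative: some entry must stand for a point pair, and two would
  -- contradict `one`. Its ball covers everything, including a point at distance 3 from the centre.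
  feasible-cost : ∀ {𝓑′ reps sol} → ContainsPoints 𝓑′ → AtMostComponents 1 𝓑′ →
                  Components 𝓑′ reps → Pointwise (SmallestEnclosing 𝓑′) reps sol →
                  Feasible sol × ι 3 ≤ cost sol
  feasible-cost points one comps [] =
    contradiction (Components.complete comps (points (apex zero))) λ ()
  feasible-cost points one comps (_ ∷ _ ∷ _) =
    contradiction (components-length≤1 comps one) λ { (s≤s ()) }
  feasible-cost points one record { within = b∈ ∷ [] } (_∷_ {y = i , r} (enc , _) []) =
      (ℕ.≤-refl , ℚ.≤-trans (ι-mono {0} {3} z≤n) 3≤r ∷ [] , λ j → here (covered j))
    , subst (ι 3 ≤_) (sym (ℚ.+-identityʳ r)) 3≤r
    where
    all∈ : ∀ x → x Subset.∈ ball (i , r)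
    all∈ = enclosing-all {b′ = i , r} points one b∈ enc

    3≤r : ι 3 ≤ r
    3≤r = enclosing-radius all∈

    covered : ∀ j → d j i ≤⁺ [ r ]
    -- `Feasible` measures from the point, `ball` from the centre.
    covered j = subst (_≤⁺ [ r ]) (cong (λ e → [ ι e ]) (dist-sym i j)) (∈-ball⁻ {i = i} (all∈ j))

  -- An explicit run

  Base Added : PairSet
  Base  = Tight initial ∩ Tight D₁
  Added = λ b → b ∈ Tight D₁ × b ∉ Tight initial

  -- apex u lies in no star other than star u, so every star must be added.
  grow : ∀ u v → u ℕ.+ v ≡ m → ∀ T → Base ⊆ T →
         (∀ {b} → b ∈ T → b ∈ Base ⊎ (∃[ l ] toℕ l ℕ.< u × b ≡ star l)) →
         (∀ l → toℕ l ℕ.< u → star l ∈ T) →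
         ∃[ T′ ] Augment Added T T′ × Components T′ (star zero ∷ [])
  -- `u` counts the stars added so far and `v` those missing; with none missing, everything is
  -- connected and the augmentation may stop.
  grow u zero u≡m T base origin stars = T , stop (_ , comps , ℕ.≤-refl) , comps
    where
    T⊆𝓑 : T ⊆ 𝓑
    T⊆𝓑 {b} b∈ = go (origin b∈)
      where
      go : b ∈ Base ⊎ (∃[ l ] toℕ l ℕ.< u × b ≡ star l) → b ∈ 𝓑
      go (inj₁ ((b∈𝓑 , _) , _)) = b∈𝓑
      go (inj₂ (l , _ , refl))  = star∈𝓑 l

    comps : Components T (star zero ∷ [])
    comps = one-component T⊆𝓑 λ l →
      stars l (subst (toℕ l ℕ.<_) (trans (sym u≡m) (ℕ.+-identityʳ u)) (Fin.toℕ<n l))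
  grow u (suc v) u+v≡m T base origin stars =
    let T′ , aug , comps = grow (suc u) v (trans (sym (ℕ.+-suc u v)) u+v≡m) (T ∪ ｛ star i ｝)
           (inj₁ ∘ base)
           (Sum.[ Sum.map₂ (λ (l , l<u , e) → l , ℕ.m<n⇒m<1+n l<u , e) ∘ origin
                , (λ { refl → inj₂ (i , ℕ.s≤s (ℕ.≤-reflexive toℕ-i) , refl) }) ])
           (λ l l<1+u → Sum.[ inj₁ ∘ stars l , inj₂ ∘ star≡ l ] (ℕ.m≤n⇒m<n∨m≡n (ℕ.s≤s⁻¹ l<1+u)))
    in T′ , add many (star-tight i D₁-uniform , star∉initial i) star∉T aug , comps
    where
    u<m : u ℕ.< m
    u<m = subst (u ℕ.<_) u+v≡m (ℕ.m<m+n u ℕ.z<s)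

    i : Fin m
    i = fromℕ< u<m

    toℕ-i : toℕ i ≡ u
    toℕ-i = Fin.toℕ-fromℕ< u<m

    star≡ : ∀ l → toℕ l ≡ u → star i ≡ star l
    star≡ l e = cong star (Fin.toℕ-injective (trans toℕ-i (sym e)))

    only : ∀ {b} → b ∈ T → apex i Subset.∈ ball b → b ≡ (apex i , 0ℚ)
    only {b} b∈ i∈ = go (origin b∈) i∈
      where
      go : b ∈ Base ⊎ (∃[ l ] toℕ l ℕ.< u × b ≡ star l) →
           apex i Subset.∈ ball b → b ≡ (apex i , 0ℚ)
      go (inj₁ (b∈₀ , _))       i∈ = initial-ball b∈₀ i∈
      -- An earlier star through `apex i` has its own apex within distance 1 of it, which forces
      -- `l ≡ i` although `l` is below `u`, the index of `i`.
      go (inj₂ (l , l<u , refl)) i∈ = contradiction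
        (trans (cong toℕ (apex-separated {l} {i} (∈⇒near 1 i∈))) toℕ-i) (ℕ.<⇒≢ l<u)

    star∉T : star i ∉ T
    star∉T b∈ = contradiction (ι-injective {1} {0} (cong proj₂ (only b∈ (centre∈ 1)))) λ ()

    many : ¬ AtMostComponents 1 T
    many = isolated⇒¬one
      (λ x → base (point-tight x initial-uniform , point-tight x D₁-uniform)) only

  output-of : ∀ {T} → Augment Added Base T → Components T (star zero ∷ []) →
              Output D₁ ((apex zero , ι 3) ∷ [])
  output-of {T} aug comps = output phase comps ((encloses , smallest) ∷ [])
    where
    phase : MainPhase D₁ T
    phase = iterations ε iteration-D₁ (uniform-stops D₁-uniform) aug

    encloses : Encloses T (star zero) (apex zero , ι 3)
    -- No distance exceeds 3, so radius 3 suffices; the centre `apex zero` is an arbitrary choice.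
    encloses _ _ {x} _ = near⇒∈ 3 (dist≤3 (apex zero) x)

    smallest : ∀ {b} → Encloses T (star zero) b → ι 3 ≤ proj₂ b
    smallest {b} enc = let _ , points , one = main-phase phase in
      enclosing-radius (enclosing-all {b′ = b} points one (All.head (Components.within comps)) enc)

  -- The bound quantifies over all outputs; the existence of one keeps it from being vacuous.
  run : ∃₂ λ D sol → Output D sol
  run = let _ , aug , comps = grow 0 m refl Base (λ b∈ → b∈) inj₁ (λ _ ())
        in  D₁ , (apex zero , ι 3) ∷ [] , output-of aug comps

  -- Dual value and approximation ratio

  value : ℚ
  value = ι (K ℕ.+ 2 ℕ.* s) * c

  -- As `k = 1`, subtracting `lam D` cancels one of the `size` equal summands.
  dualValue≡ : ∀ {D} → Uniform D c → dualValue D ≡ value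
  dualValue≡ {D} (lam≡ , α≡) = begin
    sum (α D) - ι 1 * lam D                   ≡⟨ cong₂ _-_ (sum-constℚ (α D) c α≡) (cong (λ l → ι 1 * l) lam≡) ⟩
    ι size * c - ι 1 * c                      ≡⟨ cong (λ k → ι k * c - ι 1 * c) size≡ ⟩
    ι (1 ℕ.+ k) * c - ι 1 * c                 ≡⟨ cong (λ q → q * c - ι 1 * c) (ι-+ 1 k) ⟩
    (ι 1 + ι k) * c - ι 1 * c                 ≡⟨ cong (_- ι 1 * c) (ℚ.*-distribʳ-+ c (ι 1) (ι k)) ⟩
    ι 1 * c + value - ι 1 * c                 ≡⟨ cong (_- ι 1 * c) (ℚ.+-comm (ι 1 * c) value) ⟩
    value + ι 1 * c - ι 1 * c                 ≡⟨ ℚ.+-assoc value (ι 1 * c) (- (ι 1 * c)) ⟩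
    value + (ι 1 * c - ι 1 * c)               ≡⟨ cong (λ q → value + q) (ℚ.+-inverseʳ (ι 1 * c)) ⟩
    value + 0ℚ                                ≡⟨ ℚ.+-identityʳ value ⟩
    value                                     ∎
    where
    open ≡-Reasoning
    k = K ℕ.+ 2 ℕ.* s

  1≤value : 1ℚ ≤ value
  1≤value = subst₂ _≤_ (n/n≡1 K) (sym (ι*1/ (K ℕ.+ 2 ℕ.* s) K))
    (/-mono K K (K ℕ.+ 2 ℕ.* s) K (ℕ.*-monoˡ-≤ K (ℕ.m≤m+n K (2 ℕ.* s))))

  -- value = (s + 2) / s, so 3 * value exceeds 3 by 6 / s.
  3*value : ι 3 * value ≡ ι 3 + + (6 ℕ.* s) / K
  3*value = begin
    ι 3 * (ι (K ℕ.+ 2 ℕ.* s) * c)           ≡⟨ ℚ.*-assoc (ι 3) (ι (K ℕ.+ 2 ℕ.* s)) c ⟨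
    ι 3 * ι (K ℕ.+ 2 ℕ.* s) * c             ≡⟨ cong (_* c) (ι-* 3 (K ℕ.+ 2 ℕ.* s)) ⟨
    ι (3 ℕ.* (K ℕ.+ 2 ℕ.* s)) * c           ≡⟨ cong (λ k → ι k * c) (expand K s) ⟩
    ι (3 ℕ.* K ℕ.+ 6 ℕ.* s) * c             ≡⟨ cong (_* c) (ι-+ (3 ℕ.* K) (6 ℕ.* s)) ⟩
    (ι (3 ℕ.* K) + ι (6 ℕ.* s)) * c         ≡⟨ ℚ.*-distribʳ-+ c (ι (3 ℕ.* K)) (ι (6 ℕ.* s)) ⟩
    ι (3 ℕ.* K) * c + ι (6 ℕ.* s) * c       ≡⟨ cong₂ _+_ 3K*c (ι*1/ (6 ℕ.* s) K) ⟩
    ι 3 + + (6 ℕ.* s) / K                   ∎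
    where
    open ≡-Reasoning
    expand : ∀ K s → 3 ℕ.* (K ℕ.+ 2 ℕ.* s) ≡ 3 ℕ.* K ℕ.+ 6 ℕ.* s
    expand = solve-∀
    3K*c : ι (3 ℕ.* K) * c ≡ ι 3
    3K*c = trans (cong (_* c) (ι-* 3 K)) (trans (ℚ.*-assoc (ι 3) (ι K) c)
      (trans (cong (λ q → ι 3 * q) ιK*c≡1) (ℚ.*-identityʳ (ι 3))))

  -- The excess of `3 * value` over 3 is at most `η`, and `η * value` pays for it because `value` is
  -- at least 1.
  ratio-bound : ∀ η → 0ℚ ≤ η → + (6 ℕ.* s) / K ≤ η → (ι 3 - η) * value ≤ ι 3
  ratio-bound η 0≤η small = begin
    (ι 3 - η) * value                       ≡⟨ ℚ.*-distribʳ-+ value (ι 3) (- η) ⟩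
    ι 3 * value + - η * value               ≡⟨ cong₂ _+_ 3*value (sym (ℚ.neg-distribˡ-* η value)) ⟩
    ι 3 + + (6 ℕ.* s) / K - η * value       ≤⟨ ℚ.+-mono-≤ (ℚ.+-monoʳ-≤ (ι 3) small) (ℚ.neg-antimono-≤ η≤η*value) ⟩
    ι 3 + η - η                             ≡⟨ ℚ.+-assoc (ι 3) η (- η) ⟩
    ι 3 + (η - η)                           ≡⟨ cong (λ q → ι 3 + q) (ℚ.+-inverseʳ η) ⟩
    ι 3 + 0ℚ                                ≡⟨ ℚ.+-identityʳ (ι 3) ⟩
    ι 3                                     ∎
    where
    open ℚ.≤-Reasoning
    η≤η*value : η ≤ η * value
    η≤η*value = subst (_≤ η * value) (ℚ.*-identityʳ η)
      (ℚ.*-monoˡ-≤-nonNeg η {{nonNegative 0≤η}} 1≤value)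

-- With `q` the denominator of `η`, the choice `s = 2 + 6 * q` makes `6 / s` at most `1 / q`, and a
-- positive `η` has numerator at least 1.
6s/s²≤ : ∀ η → 0ℚ < η → let open LowerBound (6 ℕ.* ↧ₙ η); open Grid (6 ℕ.* ↧ₙ η) in
         + (6 ℕ.* s) / K ≤ η
6s/s²≤ η@(mkℚ (+ suc p) q-1 _) _ = subst (_ ≤_) (ℚ.↥p/↧p≡p η)
  (/-mono (6 ℕ.* s) K (suc p) q (begin
    6 ℕ.* s ℕ.* q      ≡⟨ swap s q ⟩
    6 ℕ.* q ℕ.* s      ≤⟨ ℕ.*-monoˡ-≤ s (ℕ.m≤n+m (6 ℕ.* q) 2) ⟩
    s ℕ.* s            ≤⟨ ℕ.m≤n*m K (suc p) ⟩
    suc p ℕ.* K        ∎))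
  where
  q = suc q-1
  open LowerBound (6 ℕ.* q)
  open Grid (6 ℕ.* q)
  open ℕ.≤-Reasoning
  swap : ∀ s q → 6 ℕ.* s ℕ.* q ≡ 6 ℕ.* q ℕ.* s
  swap = solve-∀
6s/s²≤ (mkℚ (+ 0) _ _)    (*<* (ℤ.+<+ ()))
6s/s²≤ (mkℚ -[1+ _ ] _ _) (*<* ())

theorem19 : ∀ (η : ℚ) → 0ℚ < η →
    Σ[ I ∈ Instance ]
      let open MinSumRadii I in
        (∃₂ λ D sol → Output D sol)
      × (∀ D sol → Output D sol →
            Feasible sol
          × 0ℚ < dualValue D
          × (+ 3 / 1 - η) * dualValue D ≤ cost sol)
theorem19 η 0<η = inst , run , λ { D sol (MinSumRadii.output phase comps balls) →
  let u , points , one = main-phase phase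
      feasible , 3≤cost = feasible-cost points one comps balls
  in  feasible
    , subst (0ℚ <_) (sym (dualValue≡ u)) (ℚ.<-≤-trans (ℚ.positive⁻¹ 1ℚ) 1≤value)
    , subst (λ v → (+ 3 / 1 - η) * v ≤ MinSumRadii.cost inst sol) (sym (dualValue≡ u))
        (ℚ.≤-trans (ratio-bound η (ℚ.<⇒≤ 0<η) (6s/s²≤ η 0<η)) 3≤cost) }
  where open LowerBound (6 ℕ.* ↧ₙ η)
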